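{- Let $k$ be a positive integer and let $G$ be a $K_{1,k}$-free graph with maximum degree $\Delta \geq 2$ having no isolated vertices. Then $\chi_{ON}(G) = O(k\ln \Delta)$; that is, there is an absolute constant $C>0$ (independent of $G$, $k$, $\Delta$) such that $\chi_{ON}(G) \le C\, k \ln \Delta$.
   Context: All graphs are simple, finite and undirected. For a vertex $v$, $N_G(v)$ is its set of neighbors (open neighborhood). A conflict-free open neighborhood (CFON) coloring of $G$ is an assignment of colors to $V(G)$ such that for every vertex $v$ some color appears exactly once in $N_G(v)$; $\chi_{ON}(G)$ is the minimum number of colors in a CFON coloring of $G$. $K_{1,k}$ is the complete bipartite graph with one vertex on one side and $k$ on the other; $G$ is $K_{1,k}$-free if it contains no induced subgraph isomorphic to $K_{1,k}$. -}

module Defs where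

open import Data.Nat using (ℕ; _≤_)
open import Data.Fin using (Fin)
open import Data.Bool using (Bool; true; false; T)
open import Data.List using (List; filter; length)
open import Data.List.Base using (allFin)
open import Data.Product using (Σ; ∃; _×_; ∃-syntax)
open import Relation.Binary.PropositionalEquality using (_≡_; _≢_)
open import Relation.Nullary using (¬_)
open import Function.Definitions using (Injective)
open import Data.Bool.Properties using (T?)

record Graph (n : ℕ) : Set where
  field
    adj   : Fin n → Fin n → Bool
    sym   : ∀ u v → adj u v ≡ adj v u
    irrefl : ∀ v → adj v v ≡ false

open Graph public

Adj : ∀ {n} → Graph n → Fin n → Fin n → Set
Adj G u v = T (adj G u v)

degree : ∀ {n} → Graph n → Fin n → ℕ
degree {n} G v = length (filter (λ u → T? (adj G v u)) (allFin n))

IsMaxDegree : ∀ {n} → Graph n → ℕ → Set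
IsMaxDegree G Δ = (∀ v → degree G v ≤ Δ) × (∃[ v ] degree G v ≡ Δ)

NoIsolated : ∀ {n} → Graph n → Set
NoIsolated G = ∀ v → ∃[ u ] Adj G v u

InducedStar : ∀ {n} → Graph n → (k : ℕ) → Set
InducedStar {n} G k =
  Σ (Fin n) λ c → Σ (Fin k → Fin n) λ f →
    Injective _≡_ _≡_ f ×
    (∀ i → Adj G c (f i)) ×
    (∀ i j → i ≢ j → ¬ Adj G (f i) (f j))

K1k-free : ∀ {n} → Graph n → ℕ → Set
K1k-free G k = ¬ InducedStar G k

IsCFON : ∀ {n m} → Graph n → (Fin n → Fin m) → Set
IsCFON {n} G c =
  ∀ v → ∃[ u ] (Adj G v u × (∀ w → Adj G v w → c w ≡ c u → w ≡ u))

-- χ_ON(G) ≤ m  (χ_ON is the least m admitting a CFON colouring with m colours)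
χON≤ : ∀ {n} → Graph n → ℕ → Set
χON≤ {n} G m = ∃[ c ] IsCFON {n} {m} G c

-- Split V into layers by a Grundy colouring: a layer is independent, so a vertex
-- sees fewer than k vertices of each layer, and at least one of each layer below
-- its own.  Let t = 8 ⌈log₂ Δ⌉ and number the layers from 0.
--
-- A vertex above layer t sees between 1 and k vertices of each of the layers
-- 1, …, t.  If these layers receive random colours from disjoint palettes of size
-- 4k, then a layer fails to serve the vertex with probability at most 1/2, all t
-- of them fail with probability at most 2^-t, and the local lemma applies.
--
-- The vertices of layers 0, …, t are served greedily: a hypergraph all of whose
-- vertices have degree at most D has a conflict-free colouring with D + 1 colours,
-- and every vertex sees at most (t + 1) k vertices of these layers.  This works
-- with colours used only on layer 0 and above layer t, except for those vertices a
-- of layer 0 that may see only layers 1, …, t.  For each of these, one neighbour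
-- (the hub of a) is protected: a vertex whose random colour agrees with that of a
-- hub it threatens is recoloured greedily from a reserve palette of k + 1 colours.
-- It threatens at most k hubs, since it sees at most k vertices of layer 0.
module Submission where

open import Defs renaming (sym to adj-sym)
open import Data.Bool using (true; false; if_then_else_; T)
open import Data.Bool.Properties using (T?)
open import Data.Fin using (Fin; zero; suc; toℕ; fromℕ<; inject≤; join; splitAt; combine)
open import Data.Fin.Properties
  using (_≟_; any?; ¬∀⟶∃¬; injective⇒≤; toℕ<n; toℕ-injective; toℕ-fromℕ<; inject≤-injective; combine-injective; splitAt-join)
open import Data.List as List using (List; []; _∷_; _++_; map; length; filter; concatMap; allFin; upTo)
import Data.List.Membership.DecPropositional as DecMembership
open import Data.List.Membership.Propositional using (_∈_; _∉_; lose; find)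
open import Data.List.Membership.Propositional.Properties
  using (∈-map⁺; ∈-map⁻; ∈-concatMap⁺; ∈-concatMap⁻; ∈-allFin; ∈-lookup; ∈-filter⁻; ∈-filter⁺; ∈-++⁺ˡ; ∈-++⁺ʳ; ∈-++⁻; ∈-upTo⁺)
open import Data.List.Membership.Setoid.Properties using (index-injective)
open import Data.List.Properties using (length-tabulate; partition-defn; length-map; length-++; length-upTo; length-filter)
open import Data.List.Relation.Binary.Permutation.Propositional using (_↭_; ↭ₛ⇒↭; ↭-sym)
open import Data.List.Relation.Binary.Permutation.Propositional.Properties using (All-resp-↭; ↭-length; filter-↭)
open import Data.List.Relation.Binary.Permutation.Setoid.Properties using (partition-↭)
open import Data.List.Relation.Unary.All as All using (All; []; _∷_)
import Data.List.Relation.Unary.All.Properties as All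
open import Data.List.Relation.Unary.AllPairs using (AllPairs; []; _∷_)
import Data.List.Relation.Unary.AllPairs.Properties as AllPairs
open import Data.List.Relation.Unary.Any using (here; there; index)
open import Data.List.Relation.Unary.Unique.Propositional using (Unique)
open import Data.List.Relation.Unary.Unique.Propositional.Properties using (filter⁺; allFin⁺)
open import Data.Nat hiding (_≟_)
open import Data.Nat.Induction using (<-wellFounded; Acc; acc)
open import Data.Nat.Logarithm using (⌈log₂_⌉; ⌈log₂⌉-mono-≤; ⌈log₂⌈n/2⌉⌉≡⌈log₂n⌉∸1)
open import Data.Nat.Properties as ℕ hiding (_≟_; suc-injective)
open import Data.Nat.Tactic.RingSolver using (solve-∀)
open import Data.Product using (_×_; _,_; proj₁; proj₂; ∃; ∃-syntax)
open import Data.Sum using (_⊎_; inj₁; inj₂; [_,_]′)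
open import Data.Sum.Properties using (inj₁-injective; inj₂-injective)
open import Data.Vec using (Vec; []; _∷_; lookup; replicate; _[_]≔_)
open import Data.Vec.Properties using (lookup∘update; lookup∘update′)
open import Function using (_∘_; id)
open import Function.Definitions using (Injective)
open import Level using (0ℓ)
open import Relation.Binary.PropositionalEquality
  using (_≡_; _≢_; refl; sym; trans; cong; cong₂; subst; setoid; module ≡-Reasoning)
open import Relation.Nullary using (¬_; Dec; yes; no; does; contradiction; _×-dec_; _⊎-dec_; ¬?)
open import Relation.Nullary.Decidable using (decidable-stable)
open import Relation.Unary using (Pred; Decidable)
open import Relation.Unary.Properties using (∁?)

private variable
  A B : Set
  P Q : Set
  M n : ℕ

open module FinMembership {n} = DecMembership (_≟_ {n}) using (_∈?_)

-- Sums and counting over lists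

ι : Dec P → ℕ
ι d = if does d then 1 else 0

ι-mono : (p : Dec P) (q : Dec Q) → (P → Q) → ι p ≤ ι q
ι-mono (no _)  _       f = z≤n
ι-mono (yes p) (yes _) f = ≤-refl
ι-mono (yes p) (no ¬q) f = contradiction (f p) ¬q

∑ : List A → (A → ℕ) → ℕ
∑ []       g = 0
∑ (x ∷ xs) g = g x + ∑ xs g

∑-mono : ∀ (xs : List A) {f g} → (∀ x → f x ≤ g x) → ∑ xs f ≤ ∑ xs g
∑-mono []       f≤g = z≤n
∑-mono (x ∷ xs) f≤g = +-mono-≤ (f≤g x) (∑-mono xs f≤g)

∑-cong : ∀ (xs : List A) {f g} → (∀ x → f x ≡ g x) → ∑ xs f ≡ ∑ xs g
∑-cong []       f≡g = refl
∑-cong (x ∷ xs) f≡g = cong₂ _+_ (f≡g x) (∑-cong xs f≡g)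

∑-+ : ∀ (xs : List A) f g → ∑ xs (λ x → f x + g x) ≡ ∑ xs f + ∑ xs g
∑-+ []       f g = refl
∑-+ (x ∷ xs) f g = trans (cong (f x + g x +_) (∑-+ xs f g)) (lemma (f x) (g x) _ _)
  where
  lemma : ∀ a b c d → a + b + (c + d) ≡ a + c + (b + d)
  lemma = solve-∀

∑-* : ∀ m (xs : List A) f → ∑ xs (λ x → m * f x) ≡ m * ∑ xs f
∑-* m []       f = sym (*-zeroʳ m)
∑-* m (x ∷ xs) f = trans (cong (m * f x +_) (∑-* m xs f)) (sym (*-distribˡ-+ m (f x) _))

∑-const : ∀ (xs : List A) m → ∑ xs (λ _ → m) ≡ length xs * m
∑-const []       m = refl
∑-const (x ∷ xs) m = cong (m +_) (∑-const xs m)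

∑-++ : ∀ (xs : List A) {ys} g → ∑ (xs ++ ys) g ≡ ∑ xs g + ∑ ys g
∑-++ []       g = refl
∑-++ (x ∷ xs) g = trans (cong (g x +_) (∑-++ xs g)) (sym (+-assoc (g x) _ _))

∑-map : ∀ (f : A → B) xs g → ∑ (map f xs) g ≡ ∑ xs (g ∘ f)
∑-map f []       g = refl
∑-map f (x ∷ xs) g = cong (g (f x) +_) (∑-map f xs g)

∑-concatMap : ∀ (f : A → List B) xs g → ∑ (concatMap f xs) g ≡ ∑ xs (λ x → ∑ (f x) g)
∑-concatMap f []       g = refl
∑-concatMap f (x ∷ xs) g = trans (∑-++ (f x) g) (cong (∑ (f x) g +_) (∑-concatMap f xs g))

∑-swap : ∀ (xs : List A) (ys : List B) (g : A → B → ℕ) →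
         ∑ xs (λ x → ∑ ys (g x)) ≡ ∑ ys (λ y → ∑ xs (λ x → g x y))
∑-swap []       ys g = sym (trans (∑-const ys 0) (*-zeroʳ (length ys)))
∑-swap (x ∷ xs) ys g =
  trans (cong (∑ ys (g x) +_) (∑-swap xs ys g)) (sym (∑-+ ys (g x) _))

count : List A → {P : Pred A 0ℓ} → Decidable P → ℕ
count xs P? = ∑ xs (ι ∘ P?)

count-mono : ∀ (xs : List A) {P Q : Pred A 0ℓ} (P? : Decidable P) (Q? : Decidable Q) →
             (∀ {x} → P x → Q x) → count xs P? ≤ count xs Q?
count-mono xs P? Q? P⊆Q = ∑-mono xs λ x → ι-mono (P? x) (Q? x) P⊆Q

count>0⇒∃ : ∀ (xs : List A) {P : Pred A 0ℓ} (P? : Decidable P) → 0 < count xs P? → ∃ P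
count>0⇒∃ (x ∷ xs) P? pos with P? x
... | yes px = x , px
... | no  _  = count>0⇒∃ xs P? pos

count≡length-filter : ∀ (xs : List A) {P : Pred A 0ℓ} (P? : Decidable P) →
                      count xs P? ≡ length (filter P? xs)
count≡length-filter []       P? = refl
count≡length-filter (x ∷ xs) P? with does (P? x)
... | true  = cong suc (count≡length-filter xs P?)
... | false = count≡length-filter xs P?

filter-∁-↭ : {P : Pred A 0ℓ} (P? : Decidable P) (xs : List A) →
             xs ↭ filter P? xs ++ filter (∁? P?) xs
filter-∁-↭ {A = A} P? xs =
  subst (λ (ys , zs) → xs ↭ ys ++ zs) (partition-defn P? xs)
        (↭ₛ⇒↭ (partition-↭ (setoid A) P? xs))

-- The lopsided local lemma, by counting

-- Lopsided form: independent says that Bad i has probability at most 1 / p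
-- conditionally on avoiding any events not adjacent to i.
module LocalLemma
  {A I : Set} (Ω : List A)
  {Bad : I → Pred A 0ℓ} (Bad? : ∀ i → Decidable (Bad i))
  {_~_ : I → I → Set} (_~?_ : ∀ i j → Dec (i ~ j))
  where

  Avoids : List I → Pred A 0ℓ
  Avoids is x = All (λ i → ¬ Bad i x) is

  avoids? : ∀ is → Decidable (Avoids is)
  avoids? is x = All.all? (λ i → ¬? (Bad? i x)) is

  #avoid : List I → ℕ
  #avoid is = count Ω (avoids? is)

  #bad : I → List I → ℕ
  #bad i is = count Ω (λ x → Bad? i x ×-dec avoids? is x)

  -- With `1 / p` as the probability bound and `d` as the number of adjacent events in `is`, this is
  -- the symmetric condition `4 d / p ≤ 1`.
  Sparse : ℕ → List I → Set
  Sparse p is = ∀ i → 4 * length (filter (i ~?_) is) ≤ p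

  sparse-tail : ∀ {p i is} → Sparse p (i ∷ is) → Sparse p is
  sparse-tail {p} {i} {is} sp j = ≤-trans (*-monoʳ-≤ 4 (shrink (j ~?_))) (sp j)
    where
    shrink : {P : Pred I 0ℓ} (P? : Decidable P) → length (filter P? is) ≤ length (filter P? (i ∷ is))
    shrink P? with does (P? i)
    ... | true  = n≤1+n _
    ... | false = ≤-refl

  sparse-↭ : ∀ {p is js} → is ↭ js → Sparse p is → Sparse p js
  sparse-↭ {p} is↭js sp j =
    subst (λ m → 4 * m ≤ p) (↭-length (filter-↭ (j ~?_) is↭js)) (sp j)

  #avoid-split : ∀ i is → #avoid is ≡ #avoid (i ∷ is) + #bad i is
  #avoid-split i is = trans (∑-cong Ω pointwise) (∑-+ Ω _ _)
    where
    pointwise : ∀ x → ι (avoids? is x) ≡ ι (avoids? (i ∷ is) x) + ι (Bad? i x ×-dec avoids? is x)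
    pointwise x with does (Bad? i x) | does (avoids? is x)
    ... | true  | true  = refl
    ... | true  | false = refl
    ... | false | true  = refl
    ... | false | false = refl

  module _ (p : ℕ) .{{_ : NonZero p}}
    (independent : ∀ i is → All (λ j → ¬ i ~ j) is → p * #bad i is ≤ #avoid is)
    where

    -- Forget the events of `is` adjacent to `i`: `independent` then gives probability at most
    -- `1 / p`. Restoring them at most halves the number of avoiding points, by `avoid-far` and
    -- sparsity, whence the factor 2. The bound `m` on the length drives the mutual induction.
    bad≤ : ∀ m is → length is ≤ m → Sparse p is → ∀ i → p * #bad i is ≤ 2 * #avoid is

    -- Removing the events of near one at a time costs a factor 1 - 2 / p each.
    avoid-far : ∀ m near far → length (near ++ far) ≤ suc m → Sparse p (near ++ far) →
                p * #avoid far ≤ p * #avoid (near ++ far) + 2 * length near * #avoid far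

    bad≤ zero []  _   sp i = ≤-trans (independent i [] []) (m≤m+n _ _)
    bad≤ (suc m) is len sp i = begin
      p * #bad i is  ≤⟨ *-monoʳ-≤ p (count-mono Ω (λ x → Bad? i x ×-dec avoids? is x)
                                                   (λ x → Bad? i x ×-dec avoids? far x)
                                       λ (b , a) → b , All.++⁻ʳ near (All-resp-↭ is↭ a)) ⟩
      p * #bad i far ≤⟨ independent i far (All.all-filter (∁? (i ~?_)) is) ⟩
      #avoid far     ≤⟨ half ⟩
      2 * #avoid is  ∎
      where
      open ≤-Reasoning
      near = filter (i ~?_) is
      far  = filter (∁? (i ~?_)) is
      is↭ : is ↭ near ++ far
      is↭ = filter-∁-↭ (i ~?_) is

      -- Sparsity makes the loss in `avoid-far` at most `p / 2` times `#avoid far`; after doubling,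
      -- one copy of `p * #avoid far` cancels.
      half : #avoid far ≤ 2 * #avoid is
      half = *-cancelˡ-≤ p (+-cancelʳ-≤ (p * #avoid far) _ _ (begin
        p * #avoid far + p * #avoid far
          ≡⟨ lemma p (#avoid far) ⟩
        2 * (p * #avoid far)
          ≤⟨ *-monoʳ-≤ 2 (avoid-far m near far (subst (_≤ suc m) (↭-length is↭) len) (sparse-↭ is↭ sp)) ⟩
        2 * (p * #avoid (near ++ far) + 2 * length near * #avoid far)
          ≤⟨ *-monoʳ-≤ 2 (+-monoˡ-≤ _ (*-monoʳ-≤ p (count-mono Ω (avoids? (near ++ far)) (avoids? is)
                                                              (All-resp-↭ (↭-sym is↭))))) ⟩
        2 * (p * #avoid is + 2 * length near * #avoid far)
          ≡⟨ lemma′ p (#avoid is) (length near) (#avoid far) ⟩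
        p * (2 * #avoid is) + 4 * length near * #avoid far
          ≤⟨ +-monoʳ-≤ _ (*-monoˡ-≤ (#avoid far) (sp i)) ⟩
        p * (2 * #avoid is) + p * #avoid far ∎))
        where
        lemma : ∀ a b → a * b + a * b ≡ 2 * (a * b)
        lemma = solve-∀
        lemma′ : ∀ a b c d → 2 * (a * b + 2 * c * d) ≡ a * (2 * b) + 4 * c * d
        lemma′ = solve-∀

    avoid-far m []         far _   _  = m≤m+n _ _
    avoid-far m (i ∷ near) far (s≤s len) sp = begin
      p * #avoid far
        ≤⟨ avoid-far m near far (m≤n⇒m≤1+n len) sp′ ⟩
      p * #avoid rest + 2 * length near * #avoid far
        ≡⟨ cong (λ a → p * a + 2 * length near * #avoid far) (#avoid-split i rest) ⟩
      p * (#avoid (i ∷ rest) + #bad i rest) + 2 * length near * #avoid far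
        ≡⟨ lemma p (#avoid (i ∷ rest)) (#bad i rest) (2 * length near * #avoid far) ⟩
      p * #avoid (i ∷ rest) + (p * #bad i rest + 2 * length near * #avoid far)
        ≤⟨ +-monoʳ-≤ (p * #avoid (i ∷ rest)) (+-monoˡ-≤ (2 * length near * #avoid far) (begin
             p * #bad i rest ≤⟨ bad≤ m rest len sp′ i ⟩
             2 * #avoid rest ≤⟨ *-monoʳ-≤ 2 (count-mono Ω (avoids? rest) (avoids? far) (All.++⁻ʳ near)) ⟩
             2 * #avoid far  ∎)) ⟩
      p * #avoid (i ∷ rest) + (2 * #avoid far + 2 * length near * #avoid far)
        ≡⟨ cong (p * #avoid (i ∷ rest) +_) (lemma′ (#avoid far) (length near)) ⟩
      p * #avoid (i ∷ rest) + 2 * suc (length near) * #avoid far ∎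
      where
      open ≤-Reasoning
      rest = near ++ far
      sp′ : Sparse p rest
      sp′ = sparse-tail sp
      lemma : ∀ a b c d → a * (b + c) + d ≡ a * b + (a * c + d)
      lemma = solve-∀
      lemma′ : ∀ a b → 2 * a + 2 * b * a ≡ 2 * (1 + b) * a
      lemma′ = solve-∀

    -- By `bad≤`, each further event removes at most a fraction `2 / p < 1` of the points avoiding
    -- the earlier ones.
    #avoid>0 : 2 < p → 0 < length Ω → ∀ is → Sparse p is → 0 < #avoid is
    #avoid>0 2<p Ω≢[] []       sp = subst (0 <_) (sym (trans (∑-const Ω 1) (*-identityʳ _))) Ω≢[]
    #avoid>0 2<p Ω≢[] (i ∷ is) sp = *-cancelˡ-< p 0 _ (+-cancelʳ-< (2 * #avoid is) _ _ (begin-strict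
      p * 0 + 2 * #avoid is                   ≡⟨ cong (_+ 2 * #avoid is) (*-zeroʳ p) ⟩
      2 * #avoid is                           <⟨ *-monoˡ-< (#avoid is) {{>-nonZero ih}} 2<p ⟩
      p * #avoid is                           ≡⟨ cong (p *_) (#avoid-split i is) ⟩
      p * (#avoid (i ∷ is) + #bad i is)       ≡⟨ *-distribˡ-+ p (#avoid (i ∷ is)) _ ⟩
      p * #avoid (i ∷ is) + p * #bad i is     ≤⟨ +-monoʳ-≤ _ (bad≤ _ is ≤-refl sp′ i) ⟩
      p * #avoid (i ∷ is) + 2 * #avoid is     ∎))
      where
      open ≤-Reasoning
      sp′ : Sparse p is
      sp′ = sparse-tail sp
      ih : 0 < #avoid is
      ih = #avoid>0 2<p Ω≢[] is sp′

    local-lemma : 2 < p → 0 < length Ω → ∀ is → Sparse p is → ∃ (Avoids is)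
    local-lemma 2<p Ω≢[] is sp = count>0⇒∃ Ω (avoids? is) (#avoid>0 2<p Ω≢[] is sp)

-- Lists without repetition

lookup-injective : ∀ {xs : List A} → Unique xs → Injective _≡_ _≡_ (List.lookup xs)
lookup-injective {xs = _ ∷ _} (_   ∷ _) {zero}  {zero}  _  = refl
lookup-injective {xs = _ ∷ _} (x∉  ∷ _) {zero}  {suc j} eq = contradiction eq (All.lookup x∉ (∈-lookup j))
lookup-injective {xs = _ ∷ _} (x∉  ∷ _) {suc i} {zero}  eq = contradiction (sym eq) (All.lookup x∉ (∈-lookup i))
lookup-injective {xs = _ ∷ _} (_   ∷ u) {suc i} {suc j} eq = cong suc (lookup-injective u eq)

unique-⊆⇒length≤ : ∀ {xs ys : List A} → Unique xs → (∀ {x} → x ∈ xs → x ∈ ys) → length xs ≤ length ys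
unique-⊆⇒length≤ {A = A} {xs} u xs⊆ys = injective⇒≤ {f = λ i → index (xs⊆ys (∈-lookup i))}
  λ eq → lookup-injective u (index-injective (setoid A) (xs⊆ys (∈-lookup _)) (xs⊆ys (∈-lookup _)) eq)

length-filter-∈ : ∀ (ys : List (Fin n)) {P : Pred (Fin n) 0ℓ} (P? : Decidable P) →
                  (∀ {i} → P i → i ∈ ys) → length (filter P? (allFin n)) ≤ length ys
length-filter-∈ {n} ys P? P⊆ys =
  unique-⊆⇒length≤ (filter⁺ P? (allFin⁺ n)) (P⊆ys ∘ proj₂ ∘ ∈-filter⁻ P? {xs = allFin n})

-- Uniformly random colourings, as the list of all vectors

vecs : ∀ M n → List (Vec (Fin M) n)
vecs M zero    = [] ∷ []
vecs M (suc n) = concatMap (λ c → map (c ∷_) (vecs M n)) (allFin M)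

∈-vecs : ∀ (x : Vec (Fin M) n) → x ∈ vecs M n
∈-vecs []      = here refl
∈-vecs (c ∷ x) = ∈-concatMap⁺ (λ c → map (c ∷_) (vecs _ _)) (lose (∈-allFin c) (∈-map⁺ (c ∷_) (∈-vecs x)))

vecs>0 : 0 < M → ∀ n → 0 < length (vecs M n)
vecs>0 {suc M} _ n with vecs (suc M) n | ∈-vecs (replicate n (zero {M}))
... | _ ∷ _ | _ = s≤s z≤n

∑-vecs-suc : ∀ (g : Vec (Fin M) (suc n) → ℕ) →
             ∑ (vecs M (suc n)) g ≡ ∑ (allFin M) (λ c → ∑ (vecs M n) (λ x → g (c ∷ x)))
∑-vecs-suc {M} {n} g = trans (∑-concatMap (λ c → map (c ∷_) (vecs M n)) (allFin M) g)
  (∑-cong (allFin M) λ c → ∑-map (c ∷_) (vecs M n) g)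

length-allFin : ∀ M → length (allFin M) ≡ M
length-allFin M = length-tabulate {n = M} id

-- A coordinate is uniform and independent of the others: overwriting coordinate `u` by each of the
-- `M` colours runs through every vector exactly `M` times.
resample : ∀ (u : Fin n) (g : Vec (Fin M) n → ℕ) →
           M * ∑ (vecs M n) g ≡ ∑ (vecs M n) (λ x → ∑ (allFin M) (λ c → g (x [ u ]≔ c)))
resample {suc n} {M} zero g = begin
  M * ∑ (vecs M (suc n)) g
    ≡⟨ cong (M *_) (trans (∑-vecs-suc g) (∑-swap (allFin M) (vecs M n) _)) ⟩
  M * S
    ≡⟨ cong (_* S) (length-allFin M) ⟨
  length (allFin M) * S
    ≡⟨ ∑-const (allFin M) S ⟨
  ∑ (allFin M) (λ _ → S)
    ≡⟨ ∑-vecs-suc (λ x → ∑ (allFin M) (λ c → g (x [ zero ]≔ c))) ⟨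
  ∑ (vecs M (suc n)) (λ x → ∑ (allFin M) (λ c → g (x [ zero ]≔ c))) ∎
  where
  open ≡-Reasoning
  S = ∑ (vecs M n) (λ x → ∑ (allFin M) (λ c → g (c ∷ x)))
resample {suc n} {M} (suc u) g = begin
  M * ∑ (vecs M (suc n)) g
    ≡⟨ cong (M *_) (∑-vecs-suc g) ⟩
  M * ∑ (allFin M) (λ d → ∑ (vecs M n) (λ x → g (d ∷ x)))
    ≡⟨ ∑-* M (allFin M) _ ⟨
  ∑ (allFin M) (λ d → M * ∑ (vecs M n) (λ x → g (d ∷ x)))
    ≡⟨ ∑-cong (allFin M) (λ d → resample u (λ x → g (d ∷ x))) ⟩
  ∑ (allFin M) (λ d → ∑ (vecs M n) (λ x → ∑ (allFin M) (λ c → g (d ∷ x [ u ]≔ c))))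
    ≡⟨ ∑-vecs-suc (λ x → ∑ (allFin M) (λ c → g (x [ suc u ]≔ c))) ⟨
  ∑ (vecs M (suc n)) (λ x → ∑ (allFin M) (λ c → g (x [ suc u ]≔ c))) ∎
  where open ≡-Reasoning

-- Tests on a random colouring

Ignores : Pred (Vec (Fin M) n) 0ℓ → Fin n → Set
Ignores P u = ∀ x y → (∀ w → w ≢ u → lookup x w ≡ lookup y w) → P x → P y

-- A pair `(u , ws)` asks whether the colour of `u` differs from all colours on `ws`; a clash is a
-- failed test.
Test : ℕ → Set
Test n = Fin n × List (Fin n)

Clash : Test n → Pred (Vec (Fin M) n) 0ℓ
Clash (u , ws) x = lookup x u ∈ map (lookup x) ws

clash? : ∀ (τ : Test n) → Decidable (Clash {M = M} τ)
clash? (u , ws) x = lookup x u ∈? map (lookup x) ws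

ι-×-≤ : ∀ {P Q : Set} (p : Dec P) (q : Dec Q) → ι (p ×-dec q) ≤ ι q * ι p
ι-×-≤ (no _)  q       = z≤n
ι-×-≤ (yes _) (yes _) = ≤-refl
ι-×-≤ (yes _) (no _)  = z≤n

map-lookup-cong : ∀ {u : Fin n} {ws} (x y : Vec (Fin M) n) → u ∉ ws →
                  (∀ w → w ≢ u → lookup x w ≡ lookup y w) → map (lookup x) ws ≡ map (lookup y) ws
map-lookup-cong {ws = []}     x y u∉ eq = refl
map-lookup-cong {ws = w ∷ ws} x y u∉ eq =
  cong₂ _∷_ (eq w λ w≡u → u∉ (here (sym w≡u))) (map-lookup-cong x y (u∉ ∘ there) eq)

clash-ignores : ∀ {u : Fin n} (τ : Test n) → u ≢ proj₁ τ → u ∉ proj₂ τ → Ignores (Clash {M = M} τ) u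
clash-ignores (w , ws) u≢w u∉ws x y eq c =
  subst (_ ∈_) (map-lookup-cong x y u∉ws eq) (subst (_∈ _) (eq w (u≢w ∘ sym)) c)

-- Resample coordinate `u`: `Q` and the colours of `ws` stay fixed, and at most `length ws` of the
-- `M` values clash.
clash-halves : ∀ {u : Fin n} {ws} → 0 < M → u ∉ ws → 2 * length ws ≤ M →
               {Q : Pred (Vec (Fin M) n) 0ℓ} (Q? : Decidable Q) → Ignores Q u →
               2 * count (vecs M n) (λ x → clash? (u , ws) x ×-dec Q? x) ≤ count (vecs M n) Q?
clash-halves {n} {M} {u} {ws} M>0 u∉ws small {Q} Q? ignores =
  *-cancelˡ-≤ M {{>-nonZero M>0}} (begin
  M * (2 * count V (λ x → clash? (u , ws) x ×-dec Q? x))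
    ≡⟨ lemma M _ ⟩
  2 * (M * count V (λ x → clash? (u , ws) x ×-dec Q? x))
    ≡⟨ cong (2 *_) (resample u (λ x → ι (clash? (u , ws) x ×-dec Q? x))) ⟩
  2 * ∑ V (λ x → ∑ (allFin M) (λ c → ι (clash? (u , ws) (x [ u ]≔ c) ×-dec Q? (x [ u ]≔ c))))
    ≤⟨ *-monoʳ-≤ 2 (∑-mono V λ x → ∑-mono (allFin M) λ c → step x c) ⟩
  2 * ∑ V (λ x → ∑ (allFin M) (λ c → ι (Q? x) * ι (c ∈? map (lookup x) ws)))
    ≤⟨ *-monoʳ-≤ 2 (∑-mono V λ x → ≤-trans (≤-reflexive (∑-* (ι (Q? x)) (allFin M) _))
                                            (*-monoʳ-≤ (ι (Q? x)) (few x))) ⟩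
  2 * ∑ V (λ x → ι (Q? x) * length ws)
    ≡⟨ cong (2 *_) (trans (∑-cong V λ x → *-comm (ι (Q? x)) (length ws)) (∑-* (length ws) V _)) ⟩
  2 * (length ws * count V Q?)
    ≡⟨ *-assoc 2 (length ws) _ ⟨
  2 * length ws * count V Q?
    ≤⟨ *-monoˡ-≤ _ small ⟩
  M * count V Q? ∎)
  where
  open ≤-Reasoning
  V = vecs M n
  lemma : ∀ a b → a * (2 * b) ≡ 2 * (a * b)
  lemma = solve-∀

  unchanged : ∀ x c w → w ≢ u → lookup (x [ u ]≔ c) w ≡ lookup x w
  unchanged x c w w≢u = lookup∘update′ w≢u x c

  step : ∀ x c → ι (clash? (u , ws) (x [ u ]≔ c) ×-dec Q? (x [ u ]≔ c)) ≤ ι (Q? x) * ι (c ∈? map (lookup x) ws)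
  step x c = ≤-trans
    (ι-mono (clash? (u , ws) (x [ u ]≔ c) ×-dec Q? (x [ u ]≔ c)) ((c ∈? map (lookup x) ws) ×-dec Q? x)
      λ (cl , q) → subst (_∈ _) (lookup∘update u x c)
                     (subst (_ ∈_) (map-lookup-cong (x [ u ]≔ c) x u∉ws (unchanged x c)) cl)
                 , ignores (x [ u ]≔ c) x (unchanged x c) q)
    (ι-×-≤ (c ∈? map (lookup x) ws) (Q? x))

  few : ∀ x → count (allFin M) (λ c → c ∈? map (lookup x) ws) ≤ length ws
  few x = begin
    count (allFin M) (λ c → c ∈? map (lookup x) ws)
      ≡⟨ count≡length-filter (allFin M) (λ c → c ∈? map (lookup x) ws) ⟩
    length (filter (λ c → c ∈? map (lookup x) ws) (allFin M))
      ≤⟨ length-filter-∈ _ (λ c → c ∈? map (lookup x) ws) id ⟩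
    length (map (lookup x) ws)
      ≡⟨ length-map (lookup x) ws ⟩
    length ws ∎

Small : ℕ → Pred (Test n) 0ℓ
Small M (u , ws) = u ∉ ws × 2 * length ws ≤ M

Unaffected : Test n → Test n → Set
Unaffected (u , _) (w , ws) = u ≢ w × u ∉ ws

AllClash : List (Test n) → Pred (Vec (Fin M) n) 0ℓ
AllClash τs x = All (λ τ → Clash τ x) τs

allClash? : ∀ (τs : List (Test n)) → Decidable (AllClash {M = M} τs)
allClash? τs x = All.all? (λ τ → clash? τ x) τs

allClash-ignores : ∀ {u : Fin n} {τs} → All (λ (w , ws) → u ≢ w × u ∉ ws) τs → Ignores (AllClash {M = M} τs) u
allClash-ignores []                 x y eq []       = []
allClash-ignores ((u≢ , u∉) ∷ free) x y eq (c ∷ cs) =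
  clash-ignores _ u≢ u∉ x y eq c ∷ allClash-ignores free x y eq cs

-- Peel tests off the front: neither the later tests nor `Q` read the vertex of the front one, so
-- `clash-halves` applies with their conjunction as the condition.
allClash-bound : ∀ {τs : List (Test n)} → 0 < M → All (Small M) τs → AllPairs Unaffected τs →
                 {Q : Pred (Vec (Fin M) n) 0ℓ} (Q? : Decidable Q) → All (Ignores Q ∘ proj₁) τs →
                 2 ^ length τs * count (vecs M n) (λ x → allClash? τs x ×-dec Q? x) ≤ count (vecs M n) Q?
allClash-bound {n} {M} {[]} M>0 [] [] Q? [] =
  ≤-trans (≤-reflexive (*-identityˡ _)) (count-mono (vecs M n) (λ x → allClash? [] x ×-dec Q? x) Q? proj₂)
allClash-bound {n} {M} {τ ∷ τs} M>0 ((u∉ , small) ∷ smalls) (free ∷ frees) {Q} Q? (ig ∷ igs) = begin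
  2 * 2 ^ length τs * count V (λ x → allClash? (τ ∷ τs) x ×-dec Q? x)
    ≤⟨ *-monoʳ-≤ (2 * 2 ^ length τs) (count-mono V (λ x → allClash? (τ ∷ τs) x ×-dec Q? x) (λ x → clash? τ x ×-dec rest? x)
         λ { (c ∷ cs , q) → c , cs , q }) ⟩
  2 * 2 ^ length τs * count V (λ x → clash? τ x ×-dec rest? x)
    ≡⟨ lemma (2 ^ length τs) _ ⟩
  2 ^ length τs * (2 * count V (λ x → clash? τ x ×-dec rest? x))
    ≤⟨ *-monoʳ-≤ (2 ^ length τs) (clash-halves M>0 u∉ small rest?
         λ x y eq (cs , q) → allClash-ignores free x y eq cs , ig x y eq q) ⟩
  2 ^ length τs * count V rest?
    ≤⟨ allClash-bound M>0 smalls frees Q? igs ⟩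
  count V Q? ∎
  where
  open ≤-Reasoning
  V = vecs M n
  rest? : Decidable (λ x → AllClash τs x × Q x)
  rest? x = allClash? τs x ×-dec Q? x
  lemma : ∀ a b → 2 * a * b ≡ a * (2 * b)
  lemma = solve-∀

-- Conflict-free colouring of hypergraphs of bounded degree

∃-fresh : ∀ {D} (xs : List (Fin (suc D))) → length xs ≤ D → ∃ (_∉ xs)
∃-fresh {D} xs len = ¬∀⟶∃¬ (suc D) (_∈ xs) (_∈? xs) λ all → <⇒≱ (s≤s len)
  (≤-trans (≤-reflexive (sym (length-allFin (suc D)))) (unique-⊆⇒length≤ (allFin⁺ (suc D)) λ {i} _ → all i))

length-concatMap≤ : ∀ {B : Set} (f : A → List B) xs {b} → (∀ x → length (f x) ≤ b) →
                    length (concatMap f xs) ≤ length xs * b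
length-concatMap≤ f []       f≤b = z≤n
length-concatMap≤ f (x ∷ xs) f≤b =
  ≤-trans (≤-reflexive (length-++ (f x))) (+-mono-≤ (f≤b x) (length-concatMap≤ f xs f≤b))

UniquelyColoured : (Fin n → A) → Pred (Fin n) 0ℓ → Set
UniquelyColoured col P = ∃[ u ] (P u × (∀ w → P w → col w ≡ col u → w ≡ u))

-- Vertices are coloured from the last to the first; the unique colour of a
-- hyperedge is that of the vertex of it coloured first.
conflict-free : ∀ {m n D} {Inc : Fin m → Pred (Fin n) 0ℓ} (inc? : ∀ e → Decidable (Inc e)) →
                (∀ w → length (filter (λ e → inc? e w) (allFin m)) ≤ D) →
                ∃ λ (col : Fin n → Fin (suc D)) → ∀ e → ∃ (Inc e) → UniquelyColoured col (Inc e)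
conflict-free {n = zero}  inc? deg = (λ ()) , λ { _ (() , _) }
conflict-free {m} {suc n} {D} {Inc} inc? deg = col , unique
  where
  tail : ∃ λ (col : Fin n → Fin (suc D)) → ∀ e → ∃ (Inc e ∘ suc) → UniquelyColoured col (Inc e ∘ suc)
  tail = conflict-free (λ e → inc? e ∘ suc) (deg ∘ suc)
  col′ : Fin n → Fin (suc D)
  col′ = proj₁ tail
  unique′ : ∀ e → ∃ (Inc e ∘ suc) → UniquelyColoured col′ (Inc e ∘ suc)
  unique′ = proj₂ tail

  later? : ∀ e → Dec (∃ (Inc e ∘ suc))
  later? e = any? (inc? e ∘ suc)

  hub : ∀ e → Dec (∃ (Inc e ∘ suc)) → Fin (suc D)
  hub e (yes later) = col′ (proj₁ (unique′ e later))
  -- A placeholder: `forbidden` still gets one colour per hyperedge through the new vertex, hence at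
  -- most `D`.
  hub e (no _)      = zero

  forbidden : List (Fin (suc D))
  forbidden = map (λ e → hub e (later? e)) (filter (λ e → inc? e zero) (allFin m))

  new : ∃ (_∉ forbidden)
  new = ∃-fresh forbidden (≤-trans (≤-reflexive (length-map _ (filter (λ e → inc? e zero) (allFin m)))) (deg zero))

  col : Fin (suc n) → Fin (suc D)
  col zero    = proj₁ new
  col (suc i) = col′ i

  new≢hub : ∀ e → Inc e zero → hub e (later? e) ≢ proj₁ new
  new≢hub e z eq = proj₂ new (subst (_∈ forbidden) eq
    (∈-map⁺ (λ e → hub e (later? e)) (∈-filter⁺ (λ e → inc? e zero) (∈-allFin e) z)))

  unique : ∀ e → ∃ (Inc e) → UniquelyColoured col (Inc e)
  unique e (w , w∈e) with later? e | new≢hub e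
  ... | yes later | fresh with unique′ e later
  ...   | u , u∈e , uniq = suc u , u∈e , λ
    { zero    z∈e eq → contradiction (sym eq) (fresh z∈e)
    ; (suc i) i∈e eq → cong suc (uniq i i∈e eq) }
  unique e (zero , w∈e)  | no ¬later | _ = zero , w∈e , λ
    { zero    _   _ → refl
    ; (suc i) i∈e _ → contradiction (i , i∈e) ¬later }
  unique e (suc w , w∈e) | no ¬later | _ = contradiction (w , w∈e) ¬later

-- Neighbourhoods, walks and stars

module _ (G : Graph n) where

  nbrs : Fin n → List (Fin n)
  nbrs v = filter (λ u → T? (adj G v u)) (allFin n)

  ∈-nbrs⁺ : ∀ {v u} → Adj G v u → u ∈ nbrs v
  ∈-nbrs⁺ {v} {u} vu = ∈-filter⁺ (λ u → T? (adj G v u)) (∈-allFin u) vu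

  ∈-nbrs⁻ : ∀ {v u} → u ∈ nbrs v → Adj G v u
  ∈-nbrs⁻ {v} = proj₂ ∘ ∈-filter⁻ (λ u → T? (adj G v u)) {xs = allFin n}

  Adj-sym : ∀ {u v} → Adj G u v → Adj G v u
  Adj-sym {u} {v} = subst T (adj-sym G u v)

  -- Endpoints are listed with repetition, one for each walk, so that the bound `Δ ^ i` on the
  -- length is immediate.
  walks : ℕ → Fin n → List (Fin n)
  walks zero    v = v ∷ []
  walks (suc i) v = concatMap (walks i) (nbrs v)

  length-walks : ∀ {Δ} → (∀ v → degree G v ≤ Δ) → ∀ i v → length (walks i v) ≤ Δ ^ i
  length-walks deg zero    v = ≤-refl
  length-walks {Δ} deg (suc i) v =
    ≤-trans (length-concatMap≤ (walks i) (nbrs v) (length-walks deg i)) (*-monoˡ-≤ (Δ ^ i) (deg v))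

  walk-∷ : ∀ {v u w} i → Adj G v u → w ∈ walks i u → w ∈ walks (suc i) v
  walk-∷ i vu w∈ = ∈-concatMap⁺ (walks i) (lose (∈-nbrs⁺ vu) w∈)

  walk-uncons : ∀ {v w} i → w ∈ walks (suc i) v → ∃[ u ] (Adj G v u × w ∈ walks i u)
  walk-uncons {v} i w∈ with find (∈-concatMap⁻ (walks i) {xs = nbrs v} w∈)
  ... | u , u∈ , w∈u = u , ∈-nbrs⁻ u∈ , w∈u

  walk-++ : ∀ {u v w} i j → u ∈ walks i v → w ∈ walks j u → w ∈ walks (i + j) v
  walk-++ zero    j (here refl) w∈ = w∈
  walk-++ (suc i) j u∈ w∈ with walk-uncons i u∈
  ... | z , vz , u∈z = walk-∷ (i + j) vz (walk-++ i j u∈z w∈)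

  walk-sym : ∀ {u v} i → u ∈ walks i v → v ∈ walks i u
  walk-sym zero    (here refl) = here refl
  walk-sym {u} {v} (suc i) u∈ with walk-uncons i u∈
  ... | z , vz , u∈z = subst (λ m → v ∈ walks m u) (+-comm i 1)
    (walk-++ i 1 (walk-sym i u∈z) (walk-∷ 0 (Adj-sym vz) (here refl)))

  -- Otherwise the first `k` entries of `us` are the leaves of an induced star centred at `v`.
  independent-nbrs<k : ∀ {k v} → K1k-free G k → ∀ us → Unique us → (∀ {u} → u ∈ us → Adj G v u) →
                       (∀ {u w} → u ∈ us → w ∈ us → ¬ Adj G u w) → length us < k
  independent-nbrs<k {k} {v} free us uniq vus indep = ≰⇒> λ k≤ →
    let pos = λ (i : Fin k) → inject≤ i k≤ in
    free (v , List.lookup us ∘ pos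
         , (λ eq → inject≤-injective k≤ k≤ _ _ (lookup-injective uniq eq))
         , (λ i → vus (∈-lookup (pos i)))
         , (λ i j _ → indep (∈-lookup (pos i)) (∈-lookup (pos j))))

  -- Existence of a Grundy colouring

  Proper : (Fin n → ℕ) → Set
  Proper c = ∀ {u v} → Adj G u v → c u ≢ c v

  Greedy : (Fin n → ℕ) → Set
  Greedy c = ∀ v {j} → j < c v → ∃[ u ] (Adj G v u × c u ≡ j)

  recolour : (Fin n → ℕ) → Fin n → ℕ → Fin n → ℕ
  recolour c v j w with w ≟ v
  ... | yes _ = j
  ... | no  _ = c w

  recolour-proper : ∀ {c v j} → Proper c → (∀ {u} → Adj G v u → c u ≢ j) → Proper (recolour c v j)
  recolour-proper {c} {v} {j} proper free {u} {w} uw eq with u ≟ v | w ≟ v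
  ... | yes refl | yes refl = proper uw refl
  ... | yes refl | no _     = free uw (sym eq)
  ... | no _     | yes refl = free (Adj-sym uw) eq
  ... | no _     | no _     = proper uw eq

  recolour-decreases : ∀ {c v j} → j < c v → ∑ (allFin n) (recolour c v j) < ∑ (allFin n) c
  recolour-decreases {c} {v} {j} j<cv = go (∈-allFin v)
    where
    le : ∀ w → recolour c v j w ≤ c w
    le w with w ≟ v
    ... | yes refl = <⇒≤ j<cv
    ... | no _     = ≤-refl
    lt : recolour c v j v < c v
    lt with v ≟ v
    ... | yes _  = j<cv
    ... | no v≢v = contradiction refl v≢v
    go : ∀ {xs} → v ∈ xs → ∑ xs (recolour c v j) < ∑ xs c
    go {_ ∷ xs} (here refl) = +-mono-<-≤ lt (∑-mono xs le)
    go {x ∷ _}  (there v∈)  = +-mono-≤-< (le x) (go v∈)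

  -- A proper colouring with minimal sum of colours is greedy.
  improve : ∀ c → Proper c → Acc _<_ (∑ (allFin n) c) → ∃[ c ] (Proper c × Greedy c)
  improve c proper (acc rec) with any? (λ v → any? {n = c v} (λ j → ¬? (any? λ u → T? (adj G v u) ×-dec c u ℕ.≟ toℕ j)))
  ... | yes (v , j , none) =
    improve (recolour c v (toℕ j)) (recolour-proper proper λ vu cu → none (_ , vu , cu))
            (rec (recolour-decreases (toℕ<n j)))
  ... | no stuck = c , proper , λ v j<cv → decidable-stable (any? λ u → T? (adj G v u) ×-dec c u ℕ.≟ _)
    λ none → stuck (v , fromℕ< j<cv , λ (u , vu , cu) → none (u , vu , trans cu (toℕ-fromℕ< j<cv)))

  greedy-colouring : ∃[ c ] (Proper c × Greedy c)
  -- The descent starts from the colouring in which all vertices have distinct colours.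
  greedy-colouring = improve toℕ (λ {u} {v} uv eq → loop uv (toℕ-injective eq)) (<-wellFounded _)
    where
    loop : ∀ {u v} → Adj G u v → u ≢ v
    loop {u} uu refl = subst T (irrefl G u) uu

-- Layers, outer colours and hubs

-- Layers 1 to t of the greedy colouring c carry the random colours; Outer is the rest.
module Layered
  (G : Graph n) {k t Δ : ℕ} (k≥1 : k ≥ 1) (deg≤ : ∀ v → degree G v ≤ Δ) (noIso : NoIsolated G) (free : K1k-free G k)
  (sparse : 4 * Δ ^ 6 ≤ 2 ^ t) (t≥2 : 2 ≤ t)
  (c : Fin n → ℕ) (proper : Proper G c) (greedy : Greedy G c)
  where

  layer : Fin n → ℕ → List (Fin n)
  layer v j = filter (λ u → c u ℕ.≟ j) (nbrs G v)

  ∈-layer⁺ : ∀ {v u j} → Adj G v u → c u ≡ j → u ∈ layer v j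
  ∈-layer⁺ {j = j} vu cu = ∈-filter⁺ (λ u → c u ℕ.≟ j) (∈-nbrs⁺ G vu) cu

  ∈-layer⁻ : ∀ {v u j} → u ∈ layer v j → Adj G v u × c u ≡ j
  ∈-layer⁻ {v} {j = j} u∈ with ∈-filter⁻ (λ u → c u ℕ.≟ j) {xs = nbrs G v} u∈
  ... | u∈N , cu = ∈-nbrs⁻ G u∈N , cu

  length-layer : ∀ v j → length (layer v j) ≤ k
  length-layer v j = <⇒≤ (independent-nbrs<k G free (layer v j)
    (filter⁺ (λ u → c u ℕ.≟ j) (filter⁺ (λ u → T? (adj G v u)) (allFin⁺ n)))
    (proj₁ ∘ ∈-layer⁻ {v})
    λ u∈ w∈ uw → proper uw (trans (proj₂ (∈-layer⁻ {v} u∈)) (sym (proj₂ (∈-layer⁻ {v} w∈)))))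

  Outer : Pred (Fin n) 0ℓ
  Outer w = c w ≡ 0 ⊎ t < c w

  outer? : Decidable Outer
  outer? w = (c w ℕ.≟ 0) ⊎-dec (t <? c w)

  inner⇒≤t : ∀ {w} → ¬ Outer w → c w ≤ t
  inner⇒≤t ¬o = ≮⇒≥ (¬o ∘ inj₂)

  -- The hyperedge of `v` is its outer neighbourhood; it is empty for `v` above layer `t`, which the
  -- random colours serve.
  Inc₁ : Fin n → Pred (Fin n) 0ℓ
  Inc₁ v w = c v ≤ t × Adj G v w × Outer w

  inc₁? : ∀ v → Decidable (Inc₁ v)
  inc₁? v w = c v ≤? t ×-dec T? (adj G v w) ×-dec outer? w

  inc₁-degree : ∀ w → length (filter (λ v → inc₁? v w) (allFin n)) ≤ suc t * k
  inc₁-degree w = ≤-trans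
    (length-filter-∈ (concatMap (layer w) (upTo (suc t))) (λ v → inc₁? v w)
      λ (cv≤t , vw , _) → ∈-concatMap⁺ (layer w) (lose (∈-upTo⁺ (s≤s cv≤t)) (∈-layer⁺ (Adj-sym G vw) refl)))
    (≤-trans (length-concatMap≤ (layer w) (upTo (suc t)) (length-layer w))
             (≤-reflexive (cong (_* k) (length-upTo (suc t)))))

  cf₁ = conflict-free inc₁? inc₁-degree
  z = proj₁ cf₁

  friend : Fin n → Fin n
  friend v = proj₁ (noIso v)

  -- The hyperedge of a layer-0 vertex `a` is its neighbourhood within the layer of its friend. The
  -- conflict-free colouring `y` of this hypergraph supplies both the reserve colours and, as
  -- uniquely coloured vertices, the hubs.
  Inc₂ : Fin n → Pred (Fin n) 0ℓ
  Inc₂ a w = c a ≡ 0 × Adj G a w × c w ≡ c (friend a)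

  inc₂? : ∀ a → Decidable (Inc₂ a)
  inc₂? a w = c a ℕ.≟ 0 ×-dec T? (adj G a w) ×-dec c w ℕ.≟ c (friend a)

  inc₂-degree : ∀ w → length (filter (λ a → inc₂? a w) (allFin n)) ≤ k
  inc₂-degree w = ≤-trans
    (length-filter-∈ (layer w 0) (λ a → inc₂? a w) λ (ca , aw , _) → ∈-layer⁺ (Adj-sym G aw) ca)
    (length-layer w 0)

  cf₂ = conflict-free inc₂? inc₂-degree
  y = proj₁ cf₂

  unique₂ : ∀ a → c a ≡ 0 → UniquelyColoured y (Inc₂ a)
  unique₂ a ca = proj₂ cf₂ a (friend a , ca , proj₂ (noIso a) , refl)

  -- Only meaningful for c a ≡ 0.
  hub : Fin n → Fin n
  hub a with c a ℕ.≟ 0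
  ... | yes ca = proj₁ (unique₂ a ca)
  ... | no _   = a

  hub-spec : ∀ {a} → c a ≡ 0 → Inc₂ a (hub a) × (∀ w → Inc₂ a w → y w ≡ y (hub a) → w ≡ hub a)
  hub-spec {a} ca with c a ℕ.≟ 0
  ... | yes ca = proj₂ (unique₂ a ca)
  ... | no ¬ca = contradiction ca ¬ca

  Peer : Fin n → Pred (Fin n) 0ℓ
  Peer u p = p ≢ u × c p ≡ c u

  peer? : ∀ u → Decidable (Peer u)
  peer? u p = ¬? (p ≟ u) ×-dec c p ℕ.≟ c u

  -- The hubs that `u` threatens: both `u` and the hub are seen by a common vertex of layer 0, and
  -- they share a layer and hence a palette.
  rivals : Fin n → List (Fin n)
  rivals u = filter (peer? u) (map hub (layer u 0))

  -- Random colours on the inner layers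

  pick : Fin n → ℕ → Fin n
  pick v j with layer v j
  -- A default value, excluded by `greedy` when `j < c v`.
  ... | []    = v
  ... | u ∷ _ = u

  pick-spec : ∀ {v j} → j < c v → Adj G v (pick v j) × c (pick v j) ≡ j
  pick-spec {v} {j} j<cv with greedy v j<cv
  ... | u , vu , cu with layer v j | ∈-layer⁺ vu cu | (λ w → ∈-layer⁻ {v} {w} {j})
  ...   | w ∷ _ | _ | spec = spec w (here refl)

  -- The first part of the list makes `u` unique among the neighbours of `v` in its layer; the
  -- rivals ensure that `u` is not recoloured.
  test : Fin n → Fin n → Test n
  test v u = u , filter (peer? u) (nbrs G v) ++ rivals u

  tests : Fin n → List (Test n)
  -- The `suc` skips layer 0, giving one test for each of the layers 1 to `t`.
  tests v = map (λ j → test v (pick v (suc (toℕ j)))) (allFin t)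

  -- Twice the size of the list of a test: at most `k` peers and at most `k` rivals.
  R : ℕ
  R = 4 * k

  ∈-test⁻ : ∀ v u {p} → p ∈ proj₂ (test v u) →
            Peer u p × (Adj G v p ⊎ ∃[ a ] (Adj G u a × c a ≡ 0 × p ≡ hub a))
  ∈-test⁻ v u p∈ with ∈-++⁻ (filter (peer? u) (nbrs G v)) p∈
  ... | inj₁ p∈N with ∈-filter⁻ (peer? u) {xs = nbrs G v} p∈N
  ...   | p∈ , peer = peer , inj₁ (∈-nbrs⁻ G p∈)
  ∈-test⁻ v u p∈ | inj₂ p∈R with ∈-filter⁻ (peer? u) {xs = map hub (layer u 0)} p∈R
  ...   | p∈ , peer with ∈-map⁻ hub p∈
  ...     | a , a∈ , p≡ with ∈-layer⁻ {u} a∈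
  ...       | ua , ca = peer , inj₂ (a , ua , ca , p≡)

  test-small : ∀ v u → Small R (test v u)
  test-small v u = (λ u∈ → proj₁ (proj₁ (∈-test⁻ v u u∈)) refl) , (begin
    2 * length (filter (peer? u) (nbrs G v) ++ rivals u)
      ≡⟨ cong (2 *_) (length-++ (filter (peer? u) (nbrs G v))) ⟩
    2 * (length (filter (peer? u) (nbrs G v)) + length (rivals u))
      ≤⟨ *-monoʳ-≤ 2 (+-mono-≤
           (≤-trans (unique-⊆⇒length≤ (filter⁺ (peer? u) (filter⁺ (λ u → T? (adj G v u)) (allFin⁺ n))) peers⊆layer)
                    (length-layer v (c u)))
           (≤-trans (length-filter (peer? u) (map hub (layer u 0)))
                    (≤-trans (≤-reflexive (length-map hub (layer u 0))) (length-layer u 0)))) ⟩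
    2 * (k + k)
      ≡⟨ lemma k ⟩
    R ∎)
    where
    open ≤-Reasoning
    lemma : ∀ a → 2 * (a + a) ≡ 4 * a
    lemma = solve-∀
    peers⊆layer : ∀ {p} → p ∈ filter (peer? u) (nbrs G v) → p ∈ layer v (c u)
    peers⊆layer p∈ with ∈-filter⁻ (peer? u) {xs = nbrs G v} p∈
    ... | p∈N , _ , cp = ∈-layer⁺ (∈-nbrs⁻ G p∈N) cp

  -- The guard makes the event impossible up to layer `t`, so that all vertices can index events.
  Bad : Fin n → Pred (Vec (Fin R) n) 0ℓ
  Bad v x = t < c v × AllClash (tests v) x

  bad? : ∀ v → Decidable (Bad v)
  bad? v x = t <? c v ×-dec allClash? (tests v) x

  -- The tests of v read only vertices at the end of a walk of length 3 from v.
  _~_ : Fin n → Fin n → Set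
  v ~ w = w ∈ walks G 6 v

  _~?_ : ∀ v w → Dec (v ~ w)
  v ~? w = w ∈? walks G 6 v

  pick-spec′ : ∀ {v} → t < c v → ∀ j → Adj G v (pick v (suc (toℕ {t} j))) × c (pick v (suc (toℕ j))) ≡ suc (toℕ j)
  pick-spec′ t<cv j = pick-spec (≤-<-trans (toℕ<n j) t<cv)

  -- Step to `u`, back to `v` and to `u` again: the length must be exactly 3, that of the walk to a
  -- rival.
  walk-nbr : ∀ {v u} → Adj G v u → u ∈ walks G 3 v
  walk-nbr vu = walk-∷ G 2 vu (walk-∷ G 1 (Adj-sym G vu) (walk-∷ G 0 vu (here refl)))

  test-walk : ∀ {v u p} → Adj G v u → p ∈ proj₂ (test v u) → p ∈ walks G 3 v
  test-walk {v} {u} vu p∈ with ∈-test⁻ v u p∈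
  ... | _ , inj₁ vp = walk-nbr vp
  ... | _ , inj₂ (a , ua , ca , refl) =
    walk-∷ G 2 vu (walk-∷ G 1 ua (walk-∷ G 0 (proj₁ (proj₂ (proj₁ (hub-spec ca)))) (here refl)))

  -- Were `u` read by a test of `w`, walks of length 3 from `v` and from `w` would meet at `u` and
  -- join to one of length 6.
  bad-ignores : ∀ {v w u} → u ∈ walks G 3 v → ¬ v ~ w → Ignores (Bad w) u
  bad-ignores {v} {w} {u} u∈v v≁w x x′ eq (t<cw , cl) =
    t<cw , allClash-ignores (All.map⁺ (All.tabulate λ {j} _ → unaffected j)) x x′ eq cl
    where
    far : u ∉ walks G 3 w
    far u∈w = v≁w (walk-++ G 3 3 u∈v (walk-sym G 3 u∈w))
    unaffected : ∀ j → u ≢ pick w (suc (toℕ {t} j)) × u ∉ proj₂ (test w (pick w (suc (toℕ j))))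
    unaffected j = (λ { refl → far (walk-nbr wp) }) , far ∘ test-walk wp
      where wp = proj₁ (pick-spec′ t<cw j)

  open LocalLemma (vecs R n) bad? _~?_

  avoids-ignores : ∀ {v u} → u ∈ walks G 3 v → ∀ {ws} → All (λ w → ¬ v ~ w) ws → Ignores (Avoids ws) u
  avoids-ignores u∈v []         x x′ eq []       = []
  avoids-ignores u∈v (v≁w ∷ as) x x′ eq (¬b ∷ bs) =
    ¬b ∘ bad-ignores u∈v v≁w x′ x (λ w w≢u → sym (eq w w≢u)) ∷ avoids-ignores u∈v as x x′ eq bs

  -- A test reads only the layer of its vertex, and the tests of `v` belong to distinct layers.
  tests-unaffected : ∀ {v} → t < c v → AllPairs Unaffected (tests v)
  tests-unaffected {v} t<cv = AllPairs.map⁺ (AllPairs.tabulate⁺ λ {i} {j} i≢j →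
    let ci = proj₂ (pick-spec′ t<cv i)
        cj = proj₂ (pick-spec′ t<cv j)
        different : ∀ {p} → p ≡ pick v (suc (toℕ i)) → c p ≢ c (pick v (suc (toℕ j)))
        different = λ { refl eq → i≢j (toℕ-injective (ℕ.suc-injective (trans (sym ci) (trans eq cj)))) }
    in (λ eq → different refl (cong c eq))
     , (λ u∈ → different refl (proj₂ (proj₁ (∈-test⁻ v _ u∈)))))

  R>0 : 0 < R
  R>0 = *-mono-≤ {1} {4} {1} {k} (s≤s z≤n) k≥1

  -- The vertices tested by `v` are ignored by all events not adjacent to `v`, so `allClash-bound`
  -- applies with avoidance of `ws` as `Q`.
  independent : ∀ v ws → All (λ w → ¬ v ~ w) ws → 2 ^ t * #bad v ws ≤ #avoid ws
  independent v ws far with t <? c v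
  ... | no  t≮cv = ≤-trans (*-monoʳ-≤ (2 ^ t) (≤-trans
    (count-mono V (λ x → bad? v x ×-dec avoids? ws x) (λ _ → no id) λ ((t<cv , _) , _) → t≮cv t<cv)
    (≤-reflexive (trans (∑-const V 0) (*-zeroʳ (length V)))))) (≤-trans (≤-reflexive (*-zeroʳ (2 ^ t))) z≤n)
    where V = vecs R n
  ... | yes t<cv = begin
    2 ^ t * #bad v ws
      ≤⟨ *-monoʳ-≤ (2 ^ t) (count-mono V (λ x → bad? v x ×-dec avoids? ws x)
           (λ x → allClash? (tests v) x ×-dec avoids? ws x) λ ((_ , cl) , av) → cl , av) ⟩
    2 ^ t * count V (λ x → allClash? (tests v) x ×-dec avoids? ws x)
      ≡⟨ cong (λ m → 2 ^ m * count V (λ x → allClash? (tests v) x ×-dec avoids? ws x))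
           (trans (length-map _ (allFin t)) (length-allFin t)) ⟨
    2 ^ length (tests v) * count V (λ x → allClash? (tests v) x ×-dec avoids? ws x)
      ≤⟨ allClash-bound R>0 (All.map⁺ (All.tabulate λ {j} _ → test-small v (pick v (suc (toℕ j)))))
           (tests-unaffected t<cv) (avoids? ws)
           (All.map⁺ (All.tabulate λ {j} _ → avoids-ignores (walk-nbr (proj₁ (pick-spec′ t<cv j))) far)) ⟩
    #avoid ws ∎
    where
    open ≤-Reasoning
    V = vecs R n

  all-sparse : Sparse (2 ^ t) (allFin n)
  all-sparse v = ≤-trans
    (*-monoʳ-≤ 4 (≤-trans (length-filter-∈ (walks G 6 v) (v ~?_) id) (length-walks G deg≤ 6 v)))
    sparse

  abstract
    good : ∃ (Avoids (allFin n))
    good = local-lemma (2 ^ t) {{m^n≢0 2 t}} independent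
      (<-≤-trans (s≤s (s≤s (s≤s z≤n))) (^-monoʳ-≤ 2 t≥2)) (vecs>0 R>0 n) (allFin n) all-sparse

  x : Vec (Fin R) n
  x = proj₁ good

  -- The final colouring

  Rejected : Pred (Fin n) 0ℓ
  Rejected w = Clash (w , rivals w) x

  rejected? : Decidable Rejected
  rejected? w = clash? (w , rivals w) x

  -- Outer vertices share one palette. Inner colours carry their layer, which keeps layers disjoint,
  -- and are either random or from the reserve.
  Colour : Set
  Colour = Fin (suc (suc t * k)) ⊎ (Fin (suc t) × (Fin R ⊎ Fin (suc k)))

  paintWith : ∀ w → Dec (Outer w) → Dec (Rejected w) → Colour
  paintWith w (yes _) _       = inj₁ (z w)
  paintWith w (no ¬o) (yes _) = inj₂ (fromℕ< (s≤s (inner⇒≤t ¬o)) , inj₂ (y w))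
  paintWith w (no ¬o) (no _)  = inj₂ (fromℕ< (s≤s (inner⇒≤t ¬o)) , inj₁ (lookup x w))

  paint : Fin n → Colour
  paint w = paintWith w (outer? w) (rejected? w)

  -- In use, `u` is an arbitrary neighbour and `w` the one claimed unique; hence rejection is
  -- recorded for `w` and acceptance for `u`.
  data Alike (u w : Fin n) : Set where
    outer    : Outer u → Outer w → z u ≡ z w → Alike u w
    rejected : ¬ Outer u → c u ≡ c w → Rejected w → y u ≡ y w → Alike u w
    accepted : ¬ Outer u → c u ≡ c w → ¬ Rejected u → lookup x u ≡ lookup x w → Alike u w

  paint-alike : ∀ u w → paint u ≡ paint w → Alike u w
  paint-alike u w = go (outer? u) (rejected? u) (outer? w) (rejected? w)
    where
    same-layer : ∀ {i j} (i≤ : i ≤ t) (j≤ : j ≤ t) → fromℕ< (s≤s i≤) ≡ fromℕ< (s≤s j≤) → i ≡ j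
    same-layer i≤ j≤ eq = trans (sym (toℕ-fromℕ< _)) (trans (cong toℕ eq) (toℕ-fromℕ< _))
    go : ∀ ou ru ow rw → paintWith u ou ru ≡ paintWith w ow rw → Alike u w
    go (yes ou) _        (yes ow) _        eq = outer ou ow (inj₁-injective eq)
    go (yes _)  _        (no _)   (yes _)  ()
    go (yes _)  _        (no _)   (no _)   ()
    go (no _)   (yes _)  (yes _)  _        ()
    go (no _)   (no _)   (yes _)  _        ()
    go (no ou)  (yes _)  (no ow)  (yes rw) eq =
      rejected ou (same-layer (inner⇒≤t ou) (inner⇒≤t ow) (cong proj₁ (inj₂-injective eq))) rw
        (inj₂-injective (cong proj₂ (inj₂-injective eq)))
    go (no ou)  (no ru)  (no ow)  (no _)   eq =
      accepted ou (same-layer (inner⇒≤t ou) (inner⇒≤t ow) (cong proj₁ (inj₂-injective eq))) ru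
        (inj₁-injective (cong proj₂ (inj₂-injective eq)))
    go (no _)   (yes _)  (no _)   (no _)   ()
    go (no _)   (no _)   (no _)   (yes _)  ()

  -- Every vertex sees a unique colour

  Served : Fin n → Set
  Served v = UniquelyColoured paint (Adj G v)

  outer-friend-served : ∀ {v g} → c v ≤ t → Adj G v g → Outer g → Served v
  outer-friend-served {v} {g} cv≤t vg og with proj₂ cf₁ v (g , cv≤t , vg , og)
  ... | u , (_ , vu , ou) , uniq = u , vu , λ w vw eq → unique vw (paint-alike w u eq)
    where
    unique : ∀ {w} → Adj G v w → Alike w u → w ≡ u
    unique vw (outer ow _ zw≡zu)  = uniq _ (cv≤t , vw , ow) zw≡zu
    unique vw (rejected ¬ow cw≡cu _ _) = contradiction (subst (λ j → j ≡ 0 ⊎ t < j) (sym cw≡cu) ou) ¬ow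
    unique vw (accepted ¬ow cw≡cu _ _) = contradiction (subst (λ j → j ≡ 0 ⊎ t < j) (sym cw≡cu) ou) ¬ow

  -- The hub is unique whether or not it is rejected: among the neighbours of `a` in its layer its
  -- `y` is unique, and an accepted one sharing its random colour would have had the hub as a rival
  -- and been rejected.
  inner-friend-served : ∀ {a} → c a ≡ 0 → ¬ Outer (friend a) → Served a
  inner-friend-served {a} ca ¬of with hub-spec ca
  ... | (_ , ah , ch≡) , uniq = hub a , ah , λ w aw eq → unique aw (paint-alike w (hub a) eq)
    where
    unique : ∀ {w} → Adj G a w → Alike w (hub a) → w ≡ hub a
    unique aw (outer _ oh _) = contradiction (subst (λ j → j ≡ 0 ⊎ t < j) ch≡ oh) ¬of
    unique aw (rejected _ cw≡ch _ yw≡yh) = uniq _ (ca , aw , trans cw≡ch ch≡) yw≡yh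
    unique {w} aw (accepted _ cw≡ch ¬rw xw≡xh) = decidable-stable (w ≟ hub a) λ w≢h →
      ¬rw (subst (_∈ map (lookup x) (rivals w)) (sym xw≡xh) (∈-map⁺ (lookup x)
        (∈-filter⁺ (peer? w) (∈-map⁺ hub (∈-layer⁺ (Adj-sym G aw) ca)) (w≢h ∘ sym , sym cw≡ch))))

  no-clash : ∀ {v} → t < c v → ∃[ j ] ¬ Clash (test v (pick v (suc (toℕ {t} j)))) x
  no-clash {v} t<cv = ¬∀⟶∃¬ t _ (λ j → clash? (test v (pick v (suc (toℕ j)))) x) λ clash →
    All.lookup (proj₂ good) (∈-allFin v) (t<cv , All.map⁺ (All.tabulate λ {j} _ → clash j))

  -- Without a clash `u` is not rejected, since its rivals belong to the test; an accepted neighbour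
  -- of `v` painted alike would be a clashing peer.
  unclashed-unique : ∀ {v u w} → ¬ Outer u → ¬ Clash (test v u) x → Adj G v w → Alike w u → w ≡ u
  unclashed-unique ¬ou _ vw (outer _ ou _) = contradiction ou ¬ou
  unclashed-unique {v} {u} _ ¬clash vw (rejected _ _ ru _) = contradiction (clash ru) ¬clash
    where
    clash : Rejected u → Clash (test v u) x
    clash ru with ∈-map⁻ (lookup x) ru
    ... | p , p∈ , xu≡xp = subst (_∈ map (lookup x) (proj₂ (test v u))) (sym xu≡xp)
      (∈-map⁺ (lookup x) (∈-++⁺ʳ (filter (peer? u) (nbrs G v)) p∈))
  unclashed-unique {v} {u} {w} _ ¬clash vw (accepted _ cw≡cu _ xw≡xu) = decidable-stable (w ≟ u) λ w≢u →
    ¬clash (subst (_∈ map (lookup x) (proj₂ (test v u))) xw≡xu (∈-map⁺ (lookup x)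
      (∈-++⁺ˡ (∈-filter⁺ (peer? u) (∈-nbrs⁺ G vw) (w≢u , cw≡cu)))))

  high-served : ∀ {v} → t < c v → Served v
  high-served {v} t<cv =
    let (j , ¬clash) = no-clash t<cv
        (vu , cu) = pick-spec′ t<cv j
        -- The picked vertex lies in layer `suc (toℕ j)`, between 1 and `t`.
        ¬ou : ¬ Outer (pick v (suc (toℕ j)))
        ¬ou = [ (λ cu≡0 → contradiction (trans (sym cu) cu≡0) λ ())
              , (λ t<cu → ≤⇒≯ (toℕ<n j) (subst (t <_) cu t<cu)) ]′
    in pick v (suc (toℕ j)) , vu , λ w vw eq → unclashed-unique ¬ou ¬clash vw (paint-alike w (pick v (suc (toℕ j))) eq)

  served : ∀ v → Served v
  served v with t <? c v
  ... | yes t<cv = high-served t<cv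
  ... | no t≮cv with c v ℕ.≟ 0
  ...   | no cv≢0 with greedy v (n≢0⇒n>0 cv≢0)
  -- A vertex in layers 1 to `t` has a neighbour in layer 0, which is outer.
  ...     | _ , vg , cg = outer-friend-served (≮⇒≥ t≮cv) vg (inj₁ cg)
  served v | no t≮cv | yes cv≡0 with outer? (friend v)
  ...     | yes of = outer-friend-served (≮⇒≥ t≮cv) (proj₂ (noIso v)) of
  ...     | no ¬of = inner-friend-served cv≡0 ¬of

  -- Number of colours

  palette : ℕ
  palette = suc (suc t * k) + suc t * (R + suc k)

  join-injective : ∀ a b {s s′ : Fin a ⊎ Fin b} → join a b s ≡ join a b s′ → s ≡ s′
  join-injective a b {s} {s′} eq = trans (sym (splitAt-join a b s)) (trans (cong (splitAt a) eq) (splitAt-join a b s′))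

  encode : Colour → Fin palette
  encode (inj₁ a)       = join _ (suc t * (R + suc k)) (inj₁ a)
  encode (inj₂ (i , b)) = join (suc (suc t * k)) _ (inj₂ (combine i (join R (suc k) b)))

  encode-injective : ∀ {a b} → encode a ≡ encode b → a ≡ b
  encode-injective {inj₁ a} {inj₁ b} eq = cong inj₁ (inj₁-injective (join-injective (suc (suc t * k)) (suc t * (R + suc k)) eq))
  encode-injective {inj₁ a} {inj₂ b} eq with () ← join-injective (suc (suc t * k)) (suc t * (R + suc k)) {inj₁ a} {inj₂ _} eq
  encode-injective {inj₂ a} {inj₁ b} eq with () ← join-injective (suc (suc t * k)) (suc t * (R + suc k)) {inj₂ _} {inj₁ b} eq
  encode-injective {inj₂ (i , a)} {inj₂ (j , b)} eq
    with combine-injective i (join R (suc k) a) j (join R (suc k) b)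
           (inj₂-injective (join-injective (suc (suc t * k)) (suc t * (R + suc k)) {inj₂ _} {inj₂ _} eq))
  ... | refl , eq′ = cong (λ b → inj₂ (i , b)) (join-injective R (suc k) eq′)

  bounded : ∀ {m} → palette ≤ m → χON≤ G m
  bounded palette≤m = (λ v → inject≤ (encode (paint v)) palette≤m) , λ v →
    let (u , vu , uniq) = served v in
    u , vu , λ w vw eq → uniq w vw (encode-injective (inject≤-injective palette≤m palette≤m _ _ eq))

-- Choice of the parameters

≤2^⌈log₂⌉ : ∀ m → m ≤ 2 ^ ⌈log₂ m ⌉
≤2^⌈log₂⌉ m = go m (<-wellFounded m)
  where
  double : ∀ m → m ≤ 2 * ⌈ m /2⌉
  double zero          = z≤n
  double (suc zero)    = s≤s z≤n
  double (suc (suc m)) = ≤-trans (s≤s (s≤s (double m))) (≤-reflexive (sym (*-suc 2 ⌈ m /2⌉)))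

  go : ∀ m → Acc _<_ m → m ≤ 2 ^ ⌈log₂ m ⌉
  go zero          _         = z≤n
  go (suc zero)    _         = s≤s z≤n
  go m@(suc (suc m′)) (acc rec) = begin
    m                                   ≤⟨ double m ⟩
    2 * ⌈ m /2⌉                         ≤⟨ *-monoʳ-≤ 2 (go ⌈ m /2⌉ (rec (⌈n/2⌉<n m′))) ⟩
    2 * 2 ^ ⌈log₂ ⌈ m /2⌉ ⌉             ≡⟨ cong (λ i → 2 * 2 ^ i) (⌈log₂⌈n/2⌉⌉≡⌈log₂n⌉∸1 m) ⟩
    2 ^ suc (⌈log₂ m ⌉ ∸ 1)             ≡⟨ cong (2 ^_) (m+[n∸m]≡n (⌈log₂⌉-mono-≤ {2} {m} (s≤s (s≤s z≤n)))) ⟩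
    2 ^ ⌈log₂ m ⌉                       ∎
    where open ≤-Reasoning

palette≤ : ∀ {k l} → k ≥ 1 → l ≥ 1 →
           suc (suc (8 * l) * k) + suc (8 * l) * (4 * k + suc k) ≤ 64 * k * l
-- The slack is the exact difference of the two sides in terms of the predecessors; at `k = l = 1`
-- both sides are 64.
palette≤ {suc k} {suc l} _ _ = ≤-trans (m≤m+n _ (10 * k + 8 * l + 16 * k * l)) (≤-reflexive (lemma k l))
  where
  lemma : ∀ k l → suc (suc (8 * suc l) * suc k) + suc (8 * suc l) * (4 * suc k + suc (suc k))
                    + (10 * k + 8 * l + 16 * k * l)
                  ≡ 64 * suc k * suc l
  lemma = solve-∀

-- For `Δ ≥ 2` the rounded binary logarithm is at most `2 / ln 2` times `ln Δ`, so the bound has the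
-- order `k ln Δ`.
theorem3 : ∃[ C ] (C > 0 × ∀ (k : ℕ) → k ≥ 1 → ∀ (n : ℕ) (G : Graph n) (Δ : ℕ) →
    IsMaxDegree G Δ → Δ ≥ 2 → NoIsolated G → K1k-free G k →
    χON≤ G (C * k * ⌈log₂ Δ ⌉))
theorem3 = 64 , s≤s z≤n , λ k k≥1 n G Δ (deg≤ , _) Δ≥2 noIso free →
  let L = ⌈log₂ Δ ⌉
      L≥1 : 1 ≤ L
      L≥1 = ⌈log₂⌉-mono-≤ Δ≥2
      (c , proper , greedy) = greedy-colouring G
  in Layered.bounded G {t = 8 * L} k≥1 deg≤ noIso free (sparse Δ L (≤2^⌈log₂⌉ Δ) L≥1)
       (≤-trans (s≤s (s≤s z≤n)) (*-monoʳ-≤ 8 L≥1)) c proper greedy (palette≤ k≥1 L≥1)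
  where
  open ≤-Reasoning
  -- The 8 in `t = 8 * L`: six multiples of `L` pay for `Δ ^ 6`, two for the factor 4.
  sparse : ∀ Δ L → Δ ≤ 2 ^ L → 1 ≤ L → 4 * Δ ^ 6 ≤ 2 ^ (8 * L)
  sparse Δ L Δ≤ L≥1 = begin
    4 * Δ ^ 6                 ≤⟨ *-mono-≤ (^-monoʳ-≤ 2 {2} {2 * L} (*-monoʳ-≤ 2 L≥1)) (^-monoˡ-≤ 6 Δ≤) ⟩
    2 ^ (2 * L) * (2 ^ L) ^ 6 ≡⟨ cong (2 ^ (2 * L) *_) (^-*-assoc 2 L 6) ⟩
    2 ^ (2 * L) * 2 ^ (L * 6) ≡⟨ ^-distribˡ-+-* 2 (2 * L) (L * 6) ⟨
    2 ^ (2 * L + L * 6)       ≡⟨ cong (2 ^_) (lemma L) ⟩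
    2 ^ (8 * L)               ∎
    where
    lemma : ∀ L → 2 * L + L * 6 ≡ 8 * L
    lemma = solve-∀
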